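{- If an indiscernible sequence $(\bar a_i)_{i\in I}$ has a canonical base, then the canonical base is interdefinable with $\ker(\bar a_i)_{i\in I}$ (i.e. the two sets have the same definable closure).
   Context: $T$ is a complete consistent first-order theory (possibly many-sorted); we work in a big saturated model of $T$, with definable closure $\operatorname{dcl}$. Tuples may be infinite. Sequences of indiscernibles are indexed by arbitrary infinite (small) linearly ordered sets; sets of parameters are small. The kernel of a sequence of indiscernibles $(\bar a_i)_{i\in I}$ is the set $$\ker(\bar a_i)_{i\in I}=\{d\mid d\in\operatorname{dcl}(\{\bar a_i\mid i\in I\})\text{ and }(\bar a_i)_{i\in I}\text{ is indiscernible over }d\}.$$ Two sequences of indiscernibles $(\bar a_i)_{i\in I}$ and $(\bar b_j)_{j\in J}$ are cleanly collinear if one of their two concatenations (indexed by the disjoint union $I+J$ with $I<J$, or by $J+I$ with $J<I$) is indiscernible. $\approx$ denotes the transitive closure of clean collinearity. A sequence of indiscernibles $(\bar a_i)_{i\in I}$ is based on a set $B$ if every automorphism $\sigma$ of the big model that fixes $B$ pointwise satisfies $(\sigma(\bar a_i))_{i\in I}\approx(\bar a_i)_{i\in I}$. The set $B$ is a canonical base for $(\bar a_i)_{i\in I}$ if the converse is also true, i.e. if for every automorphism $\sigma$ of the big model: $\sigma$ fixes $B$ pointwise if and only if $(\sigma(\bar a_i))_{i\in I}\approx(\bar a_i)_{i\in I}$. -}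

module Defs where

open import Data.Empty using (⊥)
open import Data.Fin.Base as Fin using (Fin)
open import Data.List.Base using (List; []; _∷_)
open import Data.List.Membership.Propositional using () renaming (_∈_ to _∈ₗ_)
open import Data.List.Relation.Unary.All as All using (All; []; _∷_)
open import Data.Nat.Base using (ℕ)
open import Data.Product.Base using (Σ; ∃; ∃-syntax; Σ-syntax; _×_; _,_; proj₁)
open import Data.Sum.Base using (_⊎_; [_,_])
open import Data.Sum.Relation.Binary.LeftOrder using (_⊎-<_)
open import Function.Bundles using (_⇔_; _↔_; Inverse)
open import Level using (Level; _⊔_; suc; 0ℓ)
open import Relation.Binary.Construct.Closure.Transitive using (TransClosure)
open import Relation.Binary.Core using (Rel; _Preserves_⟶_)
open import Relation.Binary.PropositionalEquality.Core using (_≡_)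
open import Relation.Binary.Structures using (IsStrictTotalOrder)
open import Relation.Nullary.Negation.Core using (¬_)
open import Relation.Unary using (Pred; _∈_; _≐_; ∅; ｛_｝)

-- "Small" means: indexed by a type in the universe Set ℓ.  The language, the
-- index sets of sequences, the lengths of tuples and the parameter sets are
-- small; the carriers of the big model live in an arbitrary universe Set m.

record Language (ℓ : Level) : Set (suc ℓ) where
  field
    Sort : Set ℓ
    Fun  : List Sort → Sort → Set ℓ
    Rela : List Sort → Set ℓ

module Syntax {ℓ : Level} (L : Language ℓ) where
  open Language L

  -- Formula V Γ: formulas whose symbols are those of L together with a name for
  -- each element of the sorted family V (a parameter, or a free variable that is
  -- never quantified), and whose remaining free variables are listed by Γ
  -- (de Bruijn).  V may be infinite; each formula mentions finitely many names.

  data Term {v : Level} (V : Sort → Set v) (Γ : List Sort) : Sort → Set (ℓ ⊔ v) where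
    name : {s : Sort} → V s → Term V Γ s
    var  : {s : Sort} → s ∈ₗ Γ → Term V Γ s
    app  : {ss : List Sort} {s : Sort} → Fun ss s → All (Term V Γ) ss → Term V Γ s

  infixr 5 _⇒_

  -- The connectives missing here are the classical abbreviations.
  data Formula {v : Level} (V : Sort → Set v) (Γ : List Sort) : Set (ℓ ⊔ v) where
    _≈_ : {s : Sort} → Term V Γ s → Term V Γ s → Formula V Γ
    rel : {ss : List Sort} → Rela ss → All (Term V Γ) ss → Formula V Γ
    ⊥′  : Formula V Γ
    _⇒_ : Formula V Γ → Formula V Γ → Formula V Γ
    all : (s : Sort) → Formula V (s ∷ Γ) → Formula V Γ

  Sentence : Set ℓ
  Sentence = Formula {0ℓ} (λ _ → ⊥) []

  Theory : Set (suc ℓ)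
  Theory = Pred Sentence ℓ

record Structure {ℓ : Level} (L : Language ℓ) (m : Level) : Set (ℓ ⊔ suc m) where
  open Language L
  field
    Carrier : Sort → Set m
    ⟦_⟧ᶠ    : {ss : List Sort} {s : Sort} → Fun ss s → All Carrier ss → Carrier s
    ⟦_⟧ʳ    : {ss : List Sort} → Rela ss → All Carrier ss → Set m

module Semantics {ℓ m : Level} {L : Language ℓ} (M : Structure L m) where
  open Language L
  open Syntax L
  open Structure M

  Tuple : {v : Level} → (Sort → Set v) → Set (ℓ ⊔ m ⊔ v)
  Tuple V = (s : Sort) → V s → Carrier s

  module _ {v : Level} {V : Sort → Set v} (t : Tuple V) where

    eval  : {Γ : List Sort} {s : Sort} → All Carrier Γ → Term V Γ s → Carrier s
    evals : {Γ ss : List Sort} → All Carrier Γ → All (Term V Γ) ss → All Carrier ss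

    eval ρ (name x)   = t _ x
    eval ρ (var i)    = All.lookup ρ i
    eval ρ (app f us) = ⟦ f ⟧ᶠ (evals ρ us)

    evals ρ []       = []
    evals ρ (u ∷ us) = eval ρ u ∷ evals ρ us

    Sat : {Γ : List Sort} → All Carrier Γ → Formula V Γ → Set m
    Sat ρ (u ≈ w)    = eval ρ u ≡ eval ρ w
    Sat ρ (rel R us) = ⟦ R ⟧ʳ (evals ρ us)
    Sat ρ ⊥′         = Level.Lift m ⊥
    Sat ρ (φ ⇒ ψ)    = Sat ρ φ → Sat ρ ψ
    Sat ρ (all s φ)  = (x : Carrier s) → Sat (x ∷ ρ) φ

  True : Sentence → Set m
  True φ = Sat (λ _ ()) [] φ

  ModelOf : Theory → Set (ℓ ⊔ m)
  ModelOf T = {φ : Sentence} → φ ∈ T → True φ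

module _ {ℓ : Level} {L : Language ℓ} where
  open Syntax L
  open Semantics

  -- L is small, so by the Löwenheim–Skolem theorem it suffices to quantify over
  -- the small structures.

  _⊨_ : Theory → Sentence → Set (suc ℓ)
  T ⊨ φ = (N : Structure L ℓ) → ModelOf N T → True N φ

  Consistent : Theory → Set (suc ℓ)
  Consistent T = Σ[ N ∈ Structure L ℓ ] ModelOf N T

  Complete : Theory → Set (suc ℓ)
  Complete T = (φ : Sentence) → T ⊨ φ ⊎ T ⊨ (φ ⇒ ⊥′)

module ModelTheory {ℓ m : Level} {L : Language ℓ} (M : Structure L m) where
  open Language L
  open Syntax L
  open Structure M
  open Semantics M

  Element : Set (ℓ ⊔ m)
  Element = Σ Sort Carrier

  Subset : Set (suc (ℓ ⊔ m))
  Subset = Pred Element (ℓ ⊔ m)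

  Small : Subset → Set (suc ℓ ⊔ m)
  Small D = Σ[ K ∈ Set ℓ ] Σ[ k ∈ (K → Element) ] D ≐ (λ x → ∃[ i ] k i ≡ x)

  -- The names for the elements of D, and their interpretation by themselves.

  ⌜_⌝ : {p : Level} → Pred Element p → Sort → Set (m ⊔ p)
  ⌜ D ⌝ s = Σ[ x ∈ Carrier s ] (s , x) ∈ D

  self : {p : Level} (D : Pred Element p) → Tuple ⌜ D ⌝
  self D s = proj₁

  _with-names_ : {v p : Level} → (Sort → Set v) → Pred Element p → Sort → Set (m ⊔ v ⊔ p)
  (V with-names D) s = V s ⊎ ⌜ D ⌝ s

  _over_ : {v p : Level} {V : Sort → Set v} →
           Tuple V → (D : Pred Element p) → Tuple (V with-names D)
  (t over D) s = [ t s , self D s ]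

  SameType : {v p : Level} {V : Sort → Set v} →
             Pred Element p → Tuple V → Tuple V → Set (ℓ ⊔ m ⊔ v ⊔ p)
  SameType {V = V} D t t′ =
    (φ : Formula (V with-names D) []) → Sat (t over D) [] φ ⇔ Sat (t′ over D) [] φ

  dcl : {p : Level} → Pred Element p → Pred Element (ℓ ⊔ m ⊔ p)
  dcl D (s , d) =
    Σ[ φ ∈ Formula ⌜ D ⌝ (s ∷ []) ]
      Sat (self D) (d ∷ []) φ ×
      ((x : Carrier s) → Sat (self D) (x ∷ []) φ → x ≡ d)

  record Automorphism : Set (ℓ ⊔ m) where
    field
      bijection : (s : Sort) → Carrier s ↔ Carrier s

    map : (s : Sort) → Carrier s → Carrier s
    map s = Inverse.to (bijection s)

    field
      preserves-fun : {ss : List Sort} {s : Sort} (f : Fun ss s) (xs : All Carrier ss) →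
                      map s (⟦ f ⟧ᶠ xs) ≡ ⟦ f ⟧ᶠ (All.map (λ {t} → map t) xs)
      preserves-rel : {ss : List Sort} (R : Rela ss) (xs : All Carrier ss) →
                      ⟦ R ⟧ʳ xs ⇔ ⟦ R ⟧ʳ (All.map (λ {t} → map t) xs)

  open Automorphism using (map)

  FixesPointwise : Automorphism → Subset → Set (ℓ ⊔ m)
  FixesPointwise σ B = {s : Sort} {x : Carrier s} → (s , x) ∈ B → map σ s x ≡ x

  -- Every partial type in a small tuple of variables over a small set of
  -- parameters is realized.

  Saturated : Set (suc (ℓ ⊔ m))
  Saturated =
    (A : Subset) → Small A → (V : Sort → Set ℓ) →
    (π : Pred (Formula (V with-names A) []) (ℓ ⊔ m)) →
    ((φs : List (Formula (V with-names A) [])) → All π φs →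
       Σ[ t ∈ Tuple V ] All (Sat (t over A) []) φs) →
    Σ[ t ∈ Tuple V ] ({φ : Formula (V with-names A) []} → φ ∈ π → Sat (t over A) [] φ)

  StronglyHomogeneous : Set (suc ℓ ⊔ m)
  StronglyHomogeneous =
    (V : Sort → Set ℓ) (t t′ : Tuple V) → SameType ∅ t t′ →
    Σ[ σ ∈ Automorphism ] ((s : Sort) (x : V s) → map σ s (t s x) ≡ t′ s x)

  -- A monster model.  Strong homogeneity is the usual consequence of saturation in
  -- the cardinality of the model; here smallness refers to Set ℓ rather than to the
  -- cardinality of M, so it is a separate clause.

  record BigSaturated : Set (suc (ℓ ⊔ m)) where
    field
      saturated            : Saturated
      strongly-homogeneous : StronglyHomogeneous

  -- V is the sorted index set of each tuple of the sequence.

  record Sequence (V : Sort → Set ℓ) : Set (suc ℓ ⊔ m) where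
    field
      Index              : Set ℓ
      _<_                : Rel Index ℓ
      isStrictTotalOrder : IsStrictTotalOrder _≡_ _<_
      infinite           : ¬ (Σ[ is ∈ List Index ] ((i : Index) → i ∈ₗ is))
      at                 : Index → Tuple V

  -- The concatenation of the n tuples a (i 0), …, a (i (n - 1)).

  select : {V : Sort → Set ℓ} {I : Set ℓ} {n : ℕ} →
           (I → Tuple V) → (Fin n → I) → Tuple (λ s → Fin n × V s)
  select a i s (k , x) = a (i k) s x

  IndiscernibleFamily : {p : Level} {V : Sort → Set ℓ} → Pred Element p →
                        {I : Set ℓ} → Rel I ℓ → (I → Tuple V) → Set (ℓ ⊔ m ⊔ p)
  IndiscernibleFamily D {I} _<_ a =
    (n : ℕ) (i j : Fin n → I) →
    i Preserves Fin._<_ ⟶ _<_ → j Preserves Fin._<_ ⟶ _<_ →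
    SameType D (select a i) (select a j)

  module _ {V : Sort → Set ℓ} where
    open Sequence

    IndiscernibleOver : {p : Level} → Pred Element p → Sequence V → Set (ℓ ⊔ m ⊔ p)
    IndiscernibleOver D a = IndiscernibleFamily D (_<_ a) (at a)

    Indiscernible : Sequence V → Set (ℓ ⊔ m)
    Indiscernible = IndiscernibleOver ∅

    range : Sequence V → Subset
    range a (s , d) = ∃[ i ] ∃[ x ] at a i s x ≡ d

    ker : Sequence V → Subset
    ker a d = d ∈ dcl (range a) × IndiscernibleOver ｛ d ｝ a

    -- Indiscernibility of a concatenation entails that of both parts, so neither
    -- this relation nor its transitive closure leaves the indiscernible sequences.

    CleanlyCollinear : Rel (Sequence V) (ℓ ⊔ m)
    CleanlyCollinear a b =
      IndiscernibleFamily ∅ (_<_ a ⊎-< _<_ b) [ at a , at b ] ⊎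
      IndiscernibleFamily ∅ (_<_ b ⊎-< _<_ a) [ at b , at a ]

    _≋_ : Rel (Sequence V) (suc ℓ ⊔ m)
    _≋_ = TransClosure CleanlyCollinear

    image : Automorphism → Sequence V → Sequence V
    image σ a = record
      { Index              = Index a
      ; _<_                = _<_ a
      ; isStrictTotalOrder = isStrictTotalOrder a
      ; infinite           = infinite a
      ; at                 = λ i s x → map σ s (at a i s x)
      }

    IsCanonicalBase : Subset → Sequence V → Set (suc ℓ ⊔ m)
    IsCanonicalBase B a = (σ : Automorphism) → FixesPointwise σ B ⇔ (image σ a ≋ a)

{-# OPTIONS --safe #-}
module Submission where

open import Defs
open import Axiom.ExcludedMiddle using (ExcludedMiddle)
open import Data.Empty using (⊥; ⊥-elim)
open import Data.Fin.Base as Fin using (Fin; zero; suc)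
open import Data.Fin.Properties as Fin using ()
open import Data.List.Base as List using (List; []; _∷_; _++_)
open import Data.List.Membership.Propositional using () renaming (_∈_ to _∈ₗ_)
open import Data.List.Membership.Propositional.Properties
  using (∈-++⁺ˡ; ∈-++⁺ʳ; ∈-tabulate⁺)
open import Data.List.Relation.Unary.All as All using (All; []; _∷_)
open import Data.List.Relation.Unary.All.Properties using (lookup-map)
open import Data.List.Relation.Unary.Any using (here; there)
open import Data.Maybe.Base using (Maybe; just; nothing; maybe)
open import Data.Nat.Base using (ℕ; zero; suc; s≤s; s<s⁻¹; z<s)
open import Data.Product.Base using (Σ; ∃-syntax; Σ-syntax; _×_; _,_; proj₁; proj₂)
open import Data.Sum.Base as Sum using (_⊎_; inj₁; inj₂; [_,_])
open import Data.Sum.Relation.Binary.LeftOrder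
  using (_⊎-<_; ₁∼₁; ₁∼₂; ₂∼₂; ⊎-<-transitive; ⊎-<-trichotomous)
open import Data.Sum.Relation.Binary.Pointwise using (Pointwise-≡⇒≡; ≡⇒Pointwise-≡)
open import Data.Vec.Functional as Vector using ()
open import Function.Base using (_∘_; id)
open import Function.Bundles using (_⇔_; Inverse; Equivalence; mk⇔)
open import Level using (Level; _⊔_; Lift; lift; lower)
open import Relation.Binary.Construct.Closure.Transitive using (_∷_) renaming ([_] to [_]⁺)
open import Relation.Binary.Core using (Rel; _Preserves_⟶_)
open import Relation.Binary.Definitions using (Trichotomous; tri<; tri≈; tri>)
open import Relation.Binary.PropositionalEquality
  using (_≡_; refl; sym; trans; cong; cong₂; subst; isEquivalence)
open import Relation.Binary.Structures using (IsStrictTotalOrder)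
open import Relation.Binary.Structures.Biased using (isStrictTotalOrderᶜ)
open import Relation.Nullary using (¬_; yes; no)
open import Relation.Unary using (Pred; _∈_; _⊆_; _≐_; ∅; ｛_｝)

open Equivalence using (to; from)

-- By saturation and homogeneity, an element fixed by all automorphisms over a small set
-- D lies in dcl D, so both inclusions reduce to statements about automorphisms.
--
-- If d ∈ ker a, then one formula defines d from every increasing tuple of a of the
-- right length.  Whether two tuples define the same element this way is part of the type
-- of their concatenation, so the same formula still defines d from every sequence ≋ a.
-- Hence an automorphism σ with σ(a) ≋ a, in particular one fixing B, fixes ker a.
--
-- Conversely B ⊆ ker a.  Choose c such that a + c is indiscernible.  If σ fixes a or
-- fixes c, then σ(a) + c is indiscernible, so σ(a) ≋ c ≋ a and σ fixes B.  The
-- automorphisms fixing a give B ⊆ dcl a; those fixing c suffice to move any increasing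
-- tuple of a to any other of the same length, so a is indiscernible over B.

-- Linear orders and their finite chains.

⊎-<-isStrictTotalOrder-≡ :
  {a b r s : Level} {A : Set a} {B : Set b} {_<₁_ : Rel A r} {_<₂_ : Rel B s} →
  IsStrictTotalOrder _≡_ _<₁_ → IsStrictTotalOrder _≡_ _<₂_ →
  IsStrictTotalOrder _≡_ (_<₁_ ⊎-< _<₂_)
⊎-<-isStrictTotalOrder-≡ {_<₁_ = _<₁_} {_<₂_} O P = isStrictTotalOrderᶜ record
  { isEquivalence = isEquivalence
  ; trans         = ⊎-<-transitive (IsStrictTotalOrder.trans O) (IsStrictTotalOrder.trans P)
  ; compare       = compare
  }
  where
  compare : Trichotomous _≡_ (_<₁_ ⊎-< _<₂_)
  compare x y with ⊎-<-trichotomous (IsStrictTotalOrder.compare O) (IsStrictTotalOrder.compare P) x y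
  ... | tri< p q r = tri< p (q ∘ ≡⇒Pointwise-≡) r
  ... | tri≈ p q r = tri≈ p (Pointwise-≡⇒≡ q) r
  ... | tri> p q r = tri> p (q ∘ ≡⇒Pointwise-≡) r

module FiniteChains {j r : Level} {J : Set j} {_<_ : Rel J r}
                    (isStrictTotalOrder : IsStrictTotalOrder _≡_ _<_) where
  open IsStrictTotalOrder isStrictTotalOrder using (compare; irrefl) renaming (trans to <-trans)

  _↑ : {n : ℕ} → (Fin n → J) → Set r
  e ↑ = e Preserves Fin._<_ ⟶ _<_

  Covers : {n : ℕ} → (Fin n → J) → J → Set j
  Covers e x = ∃[ p ] e p ≡ x

  ∷-↑ : {n : ℕ} {x : J} {e : Fin n → J} → (∀ p → x < e p) → e ↑ → (x Vector.∷ e) ↑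
  ∷-↑ below e↑ {zero}  {suc q} _   = below q
  ∷-↑ below e↑ {suc p} {suc q} p<q = e↑ (s<s⁻¹ p<q)

  head-below : {n : ℕ} {e : Fin (suc n) → J} → e ↑ → ∀ p → e zero < e (suc p)
  head-below e↑ p = e↑ z<s

  -- The last component only serves the recursion.
  insert : (x : J) (n : ℕ) (e : Fin n → J) → e ↑ →
           Covers e x ⊎
           Σ[ e′ ∈ (Fin (suc n) → J) ] e′ ↑ × Covers e′ x × (∀ p → Covers e′ (e p)) ×
             (∀ y → y < x → (∀ p → y < e p) → ∀ q → y < e′ q)
  insert x zero e e↑ =
    inj₂ ((λ _ → x) , (λ { {zero} {zero} () }) , (zero , refl) , (λ ()) , (λ _ y<x _ _ → y<x))
  insert x (suc n) e e↑ with compare x (e zero)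
  ... | tri≈ _ x≡ _ = inj₁ (zero , sym x≡)
  ... | tri< x< _ _ =
        inj₂ ( x Vector.∷ e , ∷-↑ below e↑ , (zero , refl) , (λ p → suc p , refl)
             , λ { _ y<x _ zero → y<x ; _ _ y<e (suc p) → y<e p })
        where
        below : ∀ p → x < e p
        below zero    = x<
        below (suc p) = <-trans x< (head-below {e = e} e↑ p)
  ... | tri> _ _ x> with insert x n (e ∘ suc) (λ p<q → e↑ (s≤s p<q))
  ...   | inj₁ (p , eq) = inj₁ (suc p , eq)
  ...   | inj₂ (e′ , e′↑ , (p , eq) , old , bound) =
          inj₂ ( e zero Vector.∷ e′
               -- The bound from the recursive call, taken at `y = e zero`, says that the old head
               -- stays below the enlarged tail.
               , ∷-↑ (bound (e zero) x> (head-below {e = e} e↑)) e′↑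
               , (suc p , eq)
               , (λ { zero → zero , refl ; (suc q) → suc (proj₁ (old q)) , proj₂ (old q) })
               , λ { y _ y<e zero → y<e zero ; y y<x y<e (suc q) → bound y y<x (y<e ∘ suc) q })

  -- Insertion sort; repetitions are dropped, which makes the result strictly increasing.
  enumerate : (xs : List J) →
              Σ[ n ∈ ℕ ] Σ[ e ∈ (Fin n → J) ] e ↑ × (∀ {x} → x ∈ₗ xs → Covers e x)
  enumerate [] = 0 , (λ ()) , (λ { {()} }) , λ ()
  enumerate (x ∷ xs) with enumerate xs
  ... | n , e , e↑ , covers with insert x n e e↑
  ...   | inj₁ c = n , e , e↑ , λ { (here refl) → c ; (there i) → covers i }
  ...   | inj₂ (e′ , e′↑ , c , old , _) = suc n , e′ , e′↑ , λ
          { (here refl) → c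
          ; (there i) → let p , eq = covers i ; q , eq′ = old p in q , trans eq′ eq }

  ↑-reflects : {n : ℕ} {e : Fin n → J} → e ↑ → ∀ {p q} → e p < e q → p Fin.< q
  ↑-reflects {e = e} e↑ {p} {q} ep<eq with Fin.<-cmp p q
  ... | tri< p<q _ _    = p<q
  ... | tri≈ _ refl _   = ⊥-elim (irrefl refl ep<eq)
  ... | tri> _ _ q<p    = ⊥-elim (irrefl refl (<-trans ep<eq (e↑ q<p)))

  module _ (em : (e : Level) → ExcludedMiddle e)
           (infinite : ¬ (Σ[ xs ∈ List J ] ((x : J) → x ∈ₗ xs))) where

    -- If a chain could not be lengthened, `insert` would find every element already on it, and its
    -- finitely many values would exhaust `J`.
    chain : (n : ℕ) → Σ[ e ∈ (Fin n → J) ] e ↑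
    chain zero = (λ ()) , λ { {()} }
    chain (suc n) with chain n
    ... | e , e↑ with em _ {P = Σ[ e′ ∈ (Fin (suc n) → J) ] e′ ↑}
    ...   | yes longer = longer
    ...   | no ¬longer = ⊥-elim (infinite (List.tabulate e , listed))
      where
      listed : ∀ x → x ∈ₗ List.tabulate e
      listed x with insert x n e e↑
      ... | inj₁ (p , eq)       = subst (_∈ₗ List.tabulate e) eq (∈-tabulate⁺ p)
      ... | inj₂ (e′ , e′↑ , _) = ⊥-elim (¬longer (e′ , e′↑))

module _ {i j r s : Level} {I : Set i} {_<₁_ : Rel I r} {J : Set j} {_<₂_ : Rel J s} where

  -- Total maps increasing on a list stand for finite partial embeddings, since `J` as a whole need
  -- not embed in `I`.
  MonotoneOn : List J → (J → I) → Set _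
  MonotoneOn ks h = ∀ {x y} → x ∈ₗ ks → y ∈ₗ ks → x <₂ y → h x <₁ h y

  -- The list is sorted into a chain of `J`, which is matched position by position with a chain of
  -- the same length in `I`.
  finite-embedding :
    ((e : Level) → ExcludedMiddle e) →
    IsStrictTotalOrder _≡_ _<₁_ → ¬ (Σ[ xs ∈ List I ] ((x : I) → x ∈ₗ xs)) →
    IsStrictTotalOrder _≡_ _<₂_ →
    (ks : List J) → Σ[ h ∈ (J → I) ] MonotoneOn ks h
  finite-embedding em O infinite P ks = h , monotone
    where
    module I = FiniteChains O
    module J = FiniteChains P
    N : ℕ
    N = proj₁ (J.enumerate ks)
    e : Fin N → J
    e = proj₁ (proj₂ (J.enumerate ks))
    e↑ : e J.↑
    e↑ = proj₁ (proj₂ (proj₂ (J.enumerate ks)))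
    covers : ∀ {x} → x ∈ₗ ks → J.Covers e x
    covers = proj₂ (proj₂ (proj₂ (J.enumerate ks)))
    c : Fin N → I
    c = proj₁ (I.chain em infinite N)
    c↑ : c I.↑
    c↑ = proj₂ (I.chain em infinite N)
    h : J → I
    h k with em _ {P = J.Covers e k}
    ... | yes (p , _) = c p
    -- An arbitrary default value: nothing is demanded of `h` off the list.
    ... | no _        = proj₁ (I.chain em infinite 1) zero
    monotone : MonotoneOn ks h
    monotone {x} {y} x∈ y∈ x<y with em _ {P = J.Covers e x} | em _ {P = J.Covers e y}
    ... | yes (p , refl) | yes (q , refl) = c↑ (J.↑-reflects {e = e} e↑ x<y)
    ... | no ¬c          | _              = ⊥-elim (¬c (covers x∈))
    ... | _              | no ¬c          = ⊥-elim (¬c (covers y∈))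

-- Substitution of names and variables in formulas.

module Substitution {ℓ : Level} (L : Language ℓ) where
  open Language L
  open Syntax L

  module _ {v : Level} {V : Sort → Set v} where

    names  : {Γ : List Sort} {s : Sort} → Term V Γ s → List (Σ Sort V)
    names* : {Γ ss : List Sort} → All (Term V Γ) ss → List (Σ Sort V)
    names (name x)   = (_ , x) ∷ []
    names (var i)    = []
    names (app f us) = names* us
    names* []        = []
    names* (u ∷ us)  = names u ++ names* us

    namesᶠ : {Γ : List Sort} → Formula V Γ → List (Σ Sort V)
    namesᶠ (u ≈ w)    = names u ++ names w
    namesᶠ (rel R us) = names* us
    namesᶠ ⊥′         = []
    namesᶠ (φ ⇒ ψ)    = namesᶠ φ ++ namesᶠ ψ
    namesᶠ (all s φ)  = namesᶠ φ

  -- Names and variables may be exchanged for one another: a parameter can become a free variable,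
  -- and a free variable can be filled by a name.
  Atom : {w : Level} → (Sort → Set w) → List Sort → Sort → Set (ℓ ⊔ w)
  Atom W Δ s = W s ⊎ s ∈ₗ Δ

  -- Only the names that occur need a replacement, so that a formula over infinitely
  -- many names can be turned into one over finitely many.
  NameMap : {v w : Level} {V : Sort → Set v} (W : Sort → Set w) →
            List (Σ Sort V) → List Sort → Set (ℓ ⊔ v ⊔ w)
  NameMap {V = V} W xs Δ = {s : Sort} (x : V s) → (s , x) ∈ₗ xs → Atom W Δ s

  VarMap : {w : Level} (W : Sort → Set w) → List Sort → List Sort → Set (ℓ ⊔ w)
  VarMap W Γ Δ = {s : Sort} → s ∈ₗ Γ → Atom W Δ s

  module _ {w : Level} {W : Sort → Set w} where

    weaken : {Δ : List Sort} {s s′ : Sort} → Atom W Δ s → Atom W (s′ ∷ Δ) s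
    weaken = Sum.map₂ there

    lift-var : {Γ Δ : List Sort} {s : Sort} → VarMap W Γ Δ → VarMap W (s ∷ Γ) (s ∷ Δ)
    lift-var r (here eq) = inj₂ (here eq)
    lift-var r (there i) = weaken (r i)

    atom : {Δ : List Sort} {s : Sort} → Atom W Δ s → Term W Δ s
    atom (inj₁ x) = name x
    atom (inj₂ i) = var i

  module _ {v w : Level} {V : Sort → Set v} {W : Sort → Set w} where

    sub  : {Γ Δ : List Sort} {s : Sort} (u : Term V Γ s) →
           NameMap W (names u) Δ → VarMap W Γ Δ → Term W Δ s
    sub* : {Γ Δ ss : List Sort} (us : All (Term V Γ) ss) →
           NameMap W (names* us) Δ → VarMap W Γ Δ → All (Term W Δ) ss
    sub (name x)   f r = atom (f x (here refl))
    sub (var i)    f r = atom (r i)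
    sub (app g us) f r = app g (sub* us f r)
    sub* []        f r = []
    sub* (u ∷ us)  f r = sub u (λ x → f x ∘ ∈-++⁺ˡ) r ∷ sub* us (λ x → f x ∘ ∈-++⁺ʳ _) r

    subᶠ : {Γ Δ : List Sort} (φ : Formula V Γ) →
           NameMap W (namesᶠ φ) Δ → VarMap W Γ Δ → Formula W Δ
    subᶠ (u ≈ w)    f r = sub u (λ x → f x ∘ ∈-++⁺ˡ) r ≈ sub w (λ x → f x ∘ ∈-++⁺ʳ _) r
    subᶠ (rel R us) f r = rel R (sub* us f r)
    subᶠ ⊥′         f r = ⊥′
    subᶠ (φ ⇒ ψ)    f r = subᶠ φ (λ x → f x ∘ ∈-++⁺ˡ) r ⇒ subᶠ ψ (λ x → f x ∘ ∈-++⁺ʳ _) r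
    subᶠ (all s φ)  f r = all s (subᶠ φ (λ x → weaken {W = W} ∘ f x) (lift-var r))

module SubstitutionLemma {ℓ m : Level} {L : Language ℓ} (M : Structure L m) where
  open Language L
  open Syntax L
  open Structure M
  open Semantics M
  open Substitution L

  module _ {w : Level} {W : Sort → Set w} where

    evalᵃ : Tuple W → {Δ : List Sort} {s : Sort} → All Carrier Δ → Atom W Δ s → Carrier s
    evalᵃ t ρ (inj₁ x) = t _ x
    evalᵃ t ρ (inj₂ i) = All.lookup ρ i

    eval-atom : (t : Tuple W) {Δ : List Sort} {s : Sort} (ρ : All Carrier Δ) (x : Atom W Δ s) →
                eval t ρ (atom x) ≡ evalᵃ t ρ x
    eval-atom t ρ (inj₁ x) = refl
    eval-atom t ρ (inj₂ i) = refl

    evalᵃ-weaken : (t : Tuple W) {Δ : List Sort} {s s′ : Sort} (ρ : All Carrier Δ) (y : Carrier s′)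
                   (x : Atom W Δ s) → evalᵃ t (y ∷ ρ) (weaken {W = W} x) ≡ evalᵃ t ρ x
    evalᵃ-weaken t ρ y (inj₁ x) = refl
    evalᵃ-weaken t ρ y (inj₂ i) = refl

  module _ {v w : Level} {V : Sort → Set v} {W : Sort → Set w} (t : Tuple W) (t′ : Tuple V) where

    NamesAgree : {xs : List (Σ Sort V)} {Δ : List Sort} → NameMap W xs Δ → All Carrier Δ → Set _
    NamesAgree {xs} f ρ = {s : Sort} (x : V s) (i : (s , x) ∈ₗ xs) →
                          evalᵃ t ρ (f x i) ≡ t′ s x

    VarsAgree : {Γ Δ : List Sort} → VarMap W Γ Δ → All Carrier Δ → All Carrier Γ → Set _
    VarsAgree {Γ} r ρ ρ′ = {s : Sort} (i : s ∈ₗ Γ) → evalᵃ t ρ (r i) ≡ All.lookup ρ′ i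

    lift-agree : {Γ Δ : List Sort} {r : VarMap W Γ Δ} {ρ : All Carrier Δ} {ρ′ : All Carrier Γ} →
                 VarsAgree r ρ ρ′ → {s : Sort} (y : Carrier s) →
                 VarsAgree (lift-var r) (y ∷ ρ) (y ∷ ρ′)
    lift-agree R y (here refl) = refl
    lift-agree {r = r} R y (there i) = trans (evalᵃ-weaken t _ y (r i)) (R i)

    eval-sub  : {Γ Δ : List Sort} {s : Sort} (u : Term V Γ s) (f : NameMap W (names u) Δ)
                (r : VarMap W Γ Δ) {ρ : All Carrier Δ} {ρ′ : All Carrier Γ} →
                NamesAgree f ρ → VarsAgree r ρ ρ′ → eval t ρ (sub u f r) ≡ eval t′ ρ′ u
    evals-sub : {Γ Δ ss : List Sort} (us : All (Term V Γ) ss) (f : NameMap W (names* us) Δ)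
                (r : VarMap W Γ Δ) {ρ : All Carrier Δ} {ρ′ : All Carrier Γ} →
                NamesAgree f ρ → VarsAgree r ρ ρ′ → evals t ρ (sub* us f r) ≡ evals t′ ρ′ us
    eval-sub (name x)   f r F R = trans (eval-atom t _ (f x _)) (F x _)
    eval-sub (var i)    f r F R = trans (eval-atom t _ (r i)) (R i)
    eval-sub (app g us) f r F R = cong ⟦ g ⟧ᶠ (evals-sub us f r F R)
    evals-sub []        f r F R = refl
    evals-sub (u ∷ us)  f r F R =
      cong₂ _∷_ (eval-sub u _ r (λ x → F x ∘ ∈-++⁺ˡ) R) (evals-sub us _ r (λ x → F x ∘ ∈-++⁺ʳ _) R)

    -- All later translations between formulas with different names go through this equivalence.
    -- Under a quantifier both assignments are extended by the same element.
    Sat-sub : {Γ Δ : List Sort} (φ : Formula V Γ) (f : NameMap W (namesᶠ φ) Δ)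
              (r : VarMap W Γ Δ) {ρ : All Carrier Δ} {ρ′ : All Carrier Γ} →
              NamesAgree f ρ → VarsAgree r ρ ρ′ → Sat t ρ (subᶠ φ f r) ⇔ Sat t′ ρ′ φ
    Sat-sub (u ≈ w) f r F R = mk⇔
      (λ p → trans (sym eq) (trans p eq′)) (λ p → trans eq (trans p (sym eq′)))
      where
      eq = eval-sub u _ r (λ x → F x ∘ ∈-++⁺ˡ) R
      eq′ = eval-sub w _ r (λ x → F x ∘ ∈-++⁺ʳ _) R
    Sat-sub (rel S us) f r F R = mk⇔ (subst ⟦ S ⟧ʳ eq) (subst ⟦ S ⟧ʳ (sym eq))
      where eq = evals-sub us f r F R
    Sat-sub ⊥′ f r F R = mk⇔ id id
    Sat-sub (φ ⇒ ψ) f r F R = mk⇔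
      (λ p → to ψ⇔ ∘ p ∘ from φ⇔) (λ p → from ψ⇔ ∘ p ∘ to φ⇔)
      where
      φ⇔ = Sat-sub φ _ r (λ x → F x ∘ ∈-++⁺ˡ) R
      ψ⇔ = Sat-sub ψ _ r (λ x → F x ∘ ∈-++⁺ʳ _) R
    Sat-sub (all s φ) f r F R = mk⇔ (λ p y → to (φ⇔ y) (p y)) (λ p y → from (φ⇔ y) (p y))
      where
      φ⇔ = λ y → Sat-sub φ _ (lift-var r)
                   (λ x i → trans (evalᵃ-weaken t _ y (f x i)) (F x i)) (lift-agree R y)

-- Automorphisms preserve satisfaction.

module AutomorphismLemma {ℓ m : Level} {L : Language ℓ} (M : Structure L m) where
  open Language L
  open Syntax L
  open Structure M
  open Semantics M
  open ModelTheory M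
  open Automorphism

  map-injective : (σ : Automorphism) {s : Sort} {x y : Carrier s} → map σ s x ≡ map σ s y → x ≡ y
  map-injective σ {s} {x} {y} p =
    trans (sym (strictlyInverseʳ x)) (trans (cong (Inverse.from (bijection σ s)) p) (strictlyInverseʳ y))
    where open Inverse (bijection σ s) using (strictlyInverseʳ)

  module _ {v : Level} {V : Sort → Set v} (σ : Automorphism) where

    infixr 5 _·_
    _·_ : Tuple V → Tuple V
    _·_ t s x = map σ s (t s x)

    map* : {Γ : List Sort} → All Carrier Γ → All Carrier Γ
    map* = All.map (λ {s} → map σ s)

    module _ (t : Tuple V) where

      eval-map  : {Γ : List Sort} {s : Sort} (ρ : All Carrier Γ) (u : Term V Γ s) →
                  map σ s (eval t ρ u) ≡ eval (_·_ t) (map* ρ) u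
      evals-map : {Γ ss : List Sort} (ρ : All Carrier Γ) (us : All (Term V Γ) ss) →
                  map* (evals t ρ us) ≡ evals (_·_ t) (map* ρ) us
      eval-map ρ (name x)   = refl
      eval-map ρ (var i)    = sym (lookup-map ρ i)
      eval-map ρ (app f us) = trans (preserves-fun σ f _) (cong ⟦ f ⟧ᶠ (evals-map ρ us))
      evals-map ρ []        = refl
      evals-map ρ (u ∷ us)  = cong₂ _∷_ (eval-map ρ u) (evals-map ρ us)

      -- Both directions are proved together because implication reverses them. Equations use
      -- injectivity of `σ`, quantifiers its surjectivity.
      Sat-map : {Γ : List Sort} (ρ : All Carrier Γ) (φ : Formula V Γ) →
                Sat t ρ φ ⇔ Sat (_·_ t) (map* ρ) φ
      Sat-map ρ (u ≈ w) = mk⇔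
        (λ p → trans (sym (eval-map ρ u)) (trans (cong (map σ _) p) (eval-map ρ w)))
        (λ p → map-injective σ (trans (eval-map ρ u) (trans p (sym (eval-map ρ w)))))
      Sat-map ρ (rel R us) = mk⇔
        (λ p → subst ⟦ R ⟧ʳ (evals-map ρ us) (to (preserves-rel σ R _) p))
        (λ p → from (preserves-rel σ R _) (subst ⟦ R ⟧ʳ (sym (evals-map ρ us)) p))
      Sat-map ρ ⊥′ = mk⇔ id id
      Sat-map ρ (φ ⇒ ψ) = mk⇔
        (λ p → to (Sat-map ρ ψ) ∘ p ∘ from (Sat-map ρ φ))
        (λ p → from (Sat-map ρ ψ) ∘ p ∘ to (Sat-map ρ φ))
      Sat-map ρ (all s φ) = mk⇔
        (λ p y → subst (λ y → Sat (_·_ t) (y ∷ map* ρ) φ) (Inverse.strictlyInverseˡ (bijection σ s) y)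
                   (to (Sat-map _ φ) (p (Inverse.from (bijection σ s) y))))
        (λ p y → from (Sat-map (y ∷ ρ) φ) (p (map σ s y)))

-- Types of tuples and indiscernible families.

module Indiscernibles {ℓ m : Level} {L : Language ℓ} (M : Structure L m) where
  open Language L
  open Syntax L
  open Structure M
  open Semantics M
  open ModelTheory M
  open Substitution L
  open SubstitutionLemma M
  open AutomorphismLemma M
  open Sequence

  Sat-cong : {v : Level} {V : Sort → Set v} {t t′ : Tuple V} {Γ : List Sort} {ρ : All Carrier Γ} →
             (∀ s x → t s x ≡ t′ s x) → (φ : Formula V Γ) → Sat t ρ φ → Sat t′ ρ φ
  Sat-cong {t = t} {t′} {ρ = ρ} t≡t′ φ p =
    to (Sat-sub t t′ φ (λ x _ → inj₁ x) inj₂ {ρ} {ρ} (λ x _ → t≡t′ _ x) (λ _ → refl))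
      (from (Sat-sub t t φ (λ x _ → inj₁ x) inj₂ {ρ} {ρ} (λ _ _ → refl) (λ _ → refl)) p)

  module _ {v p : Level} {V : Sort → Set v} {D : Pred Element p} where

    SameType-sym : {t t′ : Tuple V} → SameType D t t′ → SameType D t′ t
    SameType-sym S φ = mk⇔ (from (S φ)) (to (S φ))

    SameType-trans : {t t′ t″ : Tuple V} → SameType D t t′ → SameType D t′ t″ → SameType D t t″
    SameType-trans S S′ φ = mk⇔ (to (S′ φ) ∘ to (S φ)) (from (S φ) ∘ from (S′ φ))

    over-cong : {t t′ : Tuple V} → (∀ s x → t s x ≡ t′ s x) → ∀ s x → (t over D) s x ≡ (t′ over D) s x
    over-cong t≡t′ s (inj₁ x) = t≡t′ s x
    over-cong t≡t′ s (inj₂ y) = refl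

    SameType-≡ : {t t′ : Tuple V} → (∀ s x → t s x ≡ t′ s x) → SameType D t t′
    SameType-≡ t≡t′ φ = mk⇔ (Sat-cong (over-cong t≡t′) φ)
                            (Sat-cong (over-cong (λ s x → sym (t≡t′ s x))) φ)

    -- Only sentences true of t need to be transferred, because negations are available.
    SameType-⊆ : ((e : Level) → ExcludedMiddle e) → {t t′ : Tuple V} →
                 ((φ : Formula (V with-names D) []) → Sat (t over D) [] φ → Sat (t′ over D) [] φ) →
                 SameType D t t′
    SameType-⊆ em {t} {t′} h φ = mk⇔ (h φ) back
      where
      back : Sat (t′ over D) [] φ → Sat (t over D) [] φ
      back q with em _ {P = Sat (t over D) [] φ}
      ... | yes r = r
      ... | no ¬r = ⊥-elim (lower (h (φ ⇒ ⊥′) (lift ∘ ¬r) q))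

  Sat-over-map : {v p : Level} {V : Sort → Set v} {D : Pred Element p} (σ : Automorphism) →
                 (∀ {s x} → (s , x) ∈ D → Automorphism.map σ s x ≡ x) → (t : Tuple V) →
                 {Γ : List Sort} (ρ : All Carrier Γ) (φ : Formula (V with-names D) Γ) →
                 Sat (t over D) ρ φ ⇔ Sat ((σ · t) over D) (map* {V = V} σ ρ) φ
  Sat-over-map {D = D} σ fixes t ρ φ = mk⇔
    (Sat-cong moved φ ∘ to (Sat-map σ (t over D) ρ φ))
    (from (Sat-map σ (t over D) ρ φ) ∘ Sat-cong (λ s x → sym (moved s x)) φ)
    where
    moved : ∀ s x → (σ · (t over D)) s x ≡ ((σ · t) over D) s x
    moved s (inj₁ x)       = refl
    moved s (inj₂ (y , y∈)) = fixes y∈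

  SameType-map : {v : Level} {V : Sort → Set v} (σ : Automorphism) {t t′ : Tuple V} →
                 SameType ∅ t t′ → SameType ∅ (σ · t) (σ · t′)
  SameType-map σ {t} {t′} S φ = mk⇔
    (to (Sat-over-map σ (λ ()) t′ [] φ) ∘ to (S φ) ∘ from (Sat-over-map σ (λ ()) t [] φ))
    (to (Sat-over-map σ (λ ()) t [] φ) ∘ from (S φ) ∘ from (Sat-over-map σ (λ ()) t′ [] φ))

  -- For `K = Fin n` this is what `select` produces; an infinite `K` allows a whole sequence to be
  -- moved as one tuple.
  flat : {v k : Level} {V : Sort → Set v} {K : Set k} → (K → Tuple V) → Tuple (λ s → K × V s)
  flat f s (k , x) = f k s x

  infixr 5 _⊕_
  _⊕_ : {v i j : Level} {V : Sort → Set v} {I : Set i} {J : Set j} →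
        (I → Tuple V) → (J → Tuple V) → I ⊎ J → Tuple V
  a ⊕ c = [ a , c ]

  module _ {k r p : Level} {V : Sort → Set ℓ} {K : Set k} {_<_ : Rel K r} {D : Pred Element p}
           (O : IsStrictTotalOrder _≡_ _<_) where
    open FiniteChains O

    -- A formula mentions finitely many names, hence finitely many indices, which sort into a chain
    -- `e`. The same `ψ` serves every family `f`.
    finite-support :
      {Γ : List Sort} (φ : Formula ((λ s → K × V s) with-names D) Γ) →
      Σ[ n ∈ ℕ ] Σ[ e ∈ (Fin n → K) ] e ↑ ×
      Σ[ ψ ∈ Formula ((λ s → Fin n × V s) with-names D) Γ ]
        ((f : K → Tuple V) (ρ : All Carrier Γ) →
         Sat (flat (f ∘ e) over D) ρ ψ ⇔ Sat (flat f over D) ρ φ)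
    finite-support φ = n , e , e↑ , subᶠ φ rename inj₂ , λ f ρ →
      Sat-sub (flat (f ∘ e) over D) (flat f over D) φ rename inj₂ {ρ} {ρ} (agree f ρ) (λ _ → refl)
      where
      Names : Sort → Set _
      Names = (λ s → K × V s) with-names D
      indices : List (Σ Sort Names) → List K
      indices []                       = []
      indices ((_ , inj₁ (k , _)) ∷ xs) = k ∷ indices xs
      indices ((_ , inj₂ _) ∷ xs)       = indices xs
      ∈-indices : ∀ {s k x} (xs : List (Σ Sort Names)) → (s , inj₁ (k , x)) ∈ₗ xs → k ∈ₗ indices xs
      ∈-indices (_ ∷ _)                  (here refl) = here refl
      ∈-indices ((_ , inj₁ _) ∷ xs)      (there i)   = there (∈-indices xs i)
      ∈-indices ((_ , inj₂ _) ∷ xs)      (there i)   = ∈-indices xs i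
      finite = enumerate (indices (namesᶠ φ))
      n : ℕ
      n = proj₁ finite
      e : Fin n → K
      e = proj₁ (proj₂ finite)
      e↑ : e ↑
      e↑ = proj₁ (proj₂ (proj₂ finite))
      covers : ∀ {k} → k ∈ₗ indices (namesᶠ φ) → Covers e k
      covers = proj₂ (proj₂ (proj₂ finite))
      rename : NameMap ((λ s → Fin n × V s) with-names D) (namesᶠ φ) _
      rename (inj₁ (k , x)) i = inj₁ (inj₁ (proj₁ (covers (∈-indices _ i)) , x))
      rename (inj₂ y)       i = inj₁ (inj₂ y)
      agree : (f : K → Tuple V) (ρ : All Carrier _) →
              NamesAgree (flat (f ∘ e) over D) (flat f over D) rename ρ
      agree f ρ (inj₁ (k , x)) i = cong (λ k → f k _ x) (proj₂ (covers (∈-indices _ i)))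
      agree f ρ (inj₂ y)       i = refl

    SameType-from-finite :
      (f g : K → Tuple V) →
      ((n : ℕ) (e : Fin n → K) → e ↑ → SameType D (flat (f ∘ e)) (flat (g ∘ e))) →
      SameType D (flat f) (flat g)
    SameType-from-finite f g S φ with finite-support φ
    ... | n , e , e↑ , ψ , ψ⇔φ = mk⇔
      (to (ψ⇔φ g []) ∘ to (S n e e↑ ψ) ∘ from (ψ⇔φ f []))
      (to (ψ⇔φ f []) ∘ from (S n e e↑ ψ) ∘ from (ψ⇔φ g []))

  module _ {V : Sort → Set ℓ} {I : Set ℓ} {_<_ : Rel I ℓ} {a : I → Tuple V} where

    -- By finite support, indiscernibility passes from finite increasing tuples to increasing maps
    -- from any linear order, such as a finite chain followed by a whole sequence.
    indiscernible-along :
      {p k r : Level} {D : Pred Element p} {K : Set k} {_<′_ : Rel K r} →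
      IndiscernibleFamily D _<_ a → IsStrictTotalOrder _≡_ _<′_ →
      {g h : K → I} → g Preserves _<′_ ⟶ _<_ → h Preserves _<′_ ⟶ _<_ →
      SameType D (flat (a ∘ g)) (flat (a ∘ h))
    indiscernible-along A O {g} {h} g↑ h↑ = SameType-from-finite O (a ∘ g) (a ∘ h)
      (λ n e e↑ → A n (g ∘ e) (h ∘ e) (λ p<q → g↑ (e↑ p<q)) (λ p<q → h↑ (e↑ p<q)))

    indiscernible-map : (σ : Automorphism) → IndiscernibleFamily ∅ _<_ a →
                        IndiscernibleFamily ∅ _<_ (λ i → σ · a i)
    indiscernible-map σ A n i j i↑ j↑ = SameType-map σ (A n i j i↑ j↑)

    indiscernible-≡ : {b : I → Tuple V} → (∀ i s x → a i s x ≡ b i s x) →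
                      IndiscernibleFamily ∅ _<_ a → IndiscernibleFamily ∅ _<_ b
    indiscernible-≡ a≡b A n i j i↑ j↑ =
      SameType-trans (SameType-≡ (λ { s (p , x) → sym (a≡b (i p) s x) }))
        (SameType-trans (A n i j i↑ j↑) (SameType-≡ (λ { s (p , x) → a≡b (j p) s x })))

-- Stretching and continuing indiscernible sequences in the big model.

module Monster (em : (e : Level) → ExcludedMiddle e)
               {ℓ m : Level} {L : Language ℓ} (M : Structure L m)
               (big : ModelTheory.BigSaturated M) where
  open Language L
  open Syntax L
  open Structure M
  open Semantics M
  open ModelTheory M
  open Substitution L
  open SubstitutionLemma M
  open AutomorphismLemma M
  open Indiscernibles M
  open Automorphism
  open Sequence
  open BigSaturated big

  -- The empty set of parameters, in the universe required by saturation.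
  ∅′ : Subset
  ∅′ _ = Lift _ ⊥

  small-∅′ : Small ∅′
  small-∅′ = Lift _ ⊥ , (λ ()) , (λ ()) , λ { (() , _) }

  module _ {V : Sort → Set ℓ} (a : Sequence V) (A : Indiscernible a)
           {K : Set ℓ} {_<′_ : Rel K ℓ} (O : IsStrictTotalOrder _≡_ _<′_) where

    private
      module I = FiniteChains (isStrictTotalOrder a)
      module K = FiniteChains O
      W : Sort → Set ℓ
      W s = K × V s

    -- The formulas which hold whenever K is replaced by a copy in the given
    -- sequence of a sufficiently large finite part of K.
    EM-type : Pred (Formula (W with-names ∅′) []) (ℓ ⊔ m)
    EM-type φ = Σ[ ks ∈ List K ]
      ((h : K → Index a) → MonotoneOn {_<₁_ = _<_ a} {_<₂_ = _<′_} ks h →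
       Sat (flat (at a ∘ h) over ∅′) [] φ)

    -- The finite parts of `K` needed by the single formulas are joined into one list, and a copy of
    -- it in the index set of `a` satisfies all of them.
    EM-type-finitely-satisfiable :
      (φs : List (Formula (W with-names ∅′) [])) → All EM-type φs →
      Σ[ t ∈ Tuple W ] All (Sat (t over ∅′) []) φs
    EM-type-finitely-satisfiable φs πs =
      let ks , sat = gather φs πs
          h , h↑   = finite-embedding em (isStrictTotalOrder a) (infinite a) O ks
      in flat (at a ∘ h) , sat h h↑
      where
      gather : (φs : List (Formula (W with-names ∅′) [])) → All EM-type φs →
               Σ[ ks ∈ List K ]
                 ((h : K → Index a) → MonotoneOn {_<₁_ = _<_ a} {_<₂_ = _<′_} ks h →
                  All (Sat (flat (at a ∘ h) over ∅′) []) φs)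
      gather []       []              = [] , λ _ _ → []
      gather (φ ∷ φs) ((ks , p) ∷ πs) =
        let ks′ , ps = gather φs πs in
        ks ++ ks′ , λ h h↑ →
          p h (λ x y → h↑ (∈-++⁺ˡ x) (∈-++⁺ˡ y)) ∷
          ps h (λ x y → h↑ (∈-++⁺ʳ ks x) (∈-++⁺ʳ ks y))

    -- The new sequence realizes the Ehrenfeucht-Mostowski type of `a`. A formula true of one
    -- increasing tuple of `a` is true of all, hence belongs to that type.
    stretch : Σ[ b ∈ (K → Tuple V) ]
                ({n : ℕ} (i : Fin n → Index a) (e : Fin n → K) → i I.↑ → e K.↑ →
                 SameType ∅ (flat (at a ∘ i)) (flat (b ∘ e)))
    stretch = b , same
      where
      realization : Σ[ t ∈ Tuple W ] (∀ {φ} → φ ∈ EM-type → Sat (t over ∅′) [] φ)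
      realization = saturated ∅′ small-∅′ W EM-type EM-type-finitely-satisfiable
      b : K → Tuple V
      b k s x = proj₁ realization s (k , x)
      module _ {n : ℕ} (e : Fin n → K) (e↑ : e K.↑) where
        rename : (ψ : Formula ((λ s → Fin n × V s) with-names ∅) []) →
                 NameMap (W with-names ∅′) (namesᶠ ψ) []
        rename ψ (inj₁ (p , x)) _ = inj₁ (inj₁ (e p , x))
        along : (ψ : Formula ((λ s → Fin n × V s) with-names ∅) []) (f : K → Tuple V) →
                Sat (flat f over ∅′) [] (subᶠ ψ (rename ψ) inj₂) ⇔ Sat (flat (f ∘ e) over ∅) [] ψ
        along ψ f = Sat-sub (flat f over ∅′) (flat (f ∘ e) over ∅) ψ (rename ψ) inj₂
                      (λ { (inj₁ _) _ → refl }) (λ _ → refl)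
        transfer : (ψ : Formula ((λ s → Fin n × V s) with-names ∅) []) →
                   ((i : Fin n → Index a) → i I.↑ → Sat (flat (at a ∘ i) over ∅) [] ψ) →
                   Sat (flat (b ∘ e) over ∅) [] ψ
        transfer ψ p = to (along ψ b) (proj₂ realization {subᶠ ψ (rename ψ) inj₂}
          -- A map increasing on the values of `e` turns `e` into an increasing tuple of indices of
          -- `a`.
          ( List.tabulate e
          , λ h h↑ → from (along ψ (at a ∘ h)) (p (h ∘ e)
              (λ {x} {y} x<y → h↑ (∈-tabulate⁺ x) (∈-tabulate⁺ y) (e↑ x<y)))))
      same : {n : ℕ} (i : Fin n → Index a) (e : Fin n → K) → i I.↑ → e K.↑ →
             SameType ∅ (flat (at a ∘ i)) (flat (b ∘ e))
      same i e i↑ e↑ = SameType-⊆ em λ ψ p →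
        transfer e e↑ ψ (λ j j↑ → to (A _ i j i↑ j↑ ψ) p)

  -- The stretched sequence indexed by two copies of the index set is moved so that
  -- its first half becomes a.
  continuation : {V : Sort → Set ℓ} (a : Sequence V) → Indiscernible a →
                 Σ[ c ∈ (Index a → Tuple V) ]
                   IndiscernibleFamily ∅ (_<_ a ⊎-< _<_ a) (at a ⊕ c)
  continuation {V} a A =
    c , indiscernible-≡ {_<_ = _<_ a ⊎-< _<_ a} moved (indiscernible-map {_<_ = _<_ a ⊎-< _<_ a} {b} σ B)
    where
    O : IsStrictTotalOrder _≡_ (_<_ a)
    O = isStrictTotalOrder a
    O² = ⊎-<-isStrictTotalOrder-≡ O O
    b : Index a ⊎ Index a → Tuple V
    b = proj₁ (stretch a A O²)
    B : IndiscernibleFamily ∅ (_<_ a ⊎-< _<_ a) b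
    B n i j i↑ j↑ =
      -- Any chain of `a` of length `n` serves as the intermediary between `i` and `j`.
      let c , c↑ = FiniteChains.chain O em (infinite a) n in
      SameType-trans (SameType-sym (proj₂ (stretch a A O²) c i c↑ i↑))
                     (proj₂ (stretch a A O²) c j c↑ j↑)
    move : Σ[ σ ∈ Automorphism ] (∀ s x → map σ s (flat (b ∘ inj₁) s x) ≡ flat (at a) s x)
    move = strongly-homogeneous _ (flat (b ∘ inj₁)) (flat (at a))
      (SameType-from-finite O (b ∘ inj₁) (at a) λ n e e↑ →
        SameType-sym (proj₂ (stretch a A O²) e (inj₁ ∘ e) e↑ (λ p<q → ₁∼₁ (e↑ p<q))))
    σ : Automorphism
    σ = proj₁ move
    c : Index a → Tuple V
    c i = σ · b (inj₂ i)
    moved : ∀ k s x → (σ · b k) s x ≡ (at a ⊕ c) k s x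
    moved (inj₁ i) s x = proj₂ move s (i , x)
    moved (inj₂ i) s x = refl

  -- Definable closure and automorphisms.

  fixes-dcl : {D : Subset} (σ : Automorphism) → FixesPointwise σ D → FixesPointwise σ (dcl D)
  fixes-dcl {D} σ fixes {s} {d} (φ , holds , unique) =
    -- The parameters are fixed, so `map σ s d` satisfies the formula that defines `d`.
    unique (map σ s d) (Sat-cong (λ { _ (_ , x∈) → fixes x∈ }) φ
      (to (Sat-map σ (self D) (d ∷ []) φ) holds))

  dcl-mono : {D E : Subset} → D ⊆ E → dcl D ⊆ dcl E
  dcl-mono {D} {E} D⊆E {s , d} (φ , holds , unique) =
    subᶠ φ rename inj₂ , from (φ⇔ d) holds , λ x p → unique x (to (φ⇔ x) p)
    where
    rename : NameMap ⌜ E ⌝ (namesᶠ φ) (s ∷ [])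
    rename (x , x∈) _ = inj₁ (x , D⊆E x∈)
    φ⇔ : (x : Carrier s) → Sat (self E) (x ∷ []) (subᶠ φ rename inj₂) ⇔ Sat (self D) (x ∷ []) φ
    φ⇔ x = Sat-sub (self E) (self D) φ rename inj₂ (λ _ _ → refl) (λ _ → refl)

  module _ (D : Subset) (small : Small D) {s : Sort} (d : Carrier s) where

    private
      K : Set ℓ
      K = proj₁ small
      k : K → Element
      k = proj₁ (proj₂ small)
      D≐k : D ≐ (λ x → ∃[ i ] k i ≡ x)
      D≐k = proj₂ (proj₂ small)

      -- With `d` as an extra parameter, being different from `d` becomes a formula.
      D+d : Subset
      D+d x = x ∈ D ⊎ (s , d) ≡ x

      small-D+d : Small D+d
      small-D+d = Maybe K , maybe k (s , d)
        , (λ { (inj₁ x∈) → let i , eq = proj₁ D≐k x∈ in just i , eq ; (inj₂ eq) → nothing , eq })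
        , (λ { (just i , eq) → inj₁ (proj₂ D≐k (i , eq)) ; (nothing , eq) → inj₂ eq })

      -- The family `s ≡_` provides a single variable, of sort `s`.
      point : Carrier s → Tuple (s ≡_)
      point x _ refl = x

      -- The type of `d` over `D` together with `x ≠ d`, encoded as everything that follows in the
      -- model from `x ≠ d` and one formula true of `d`.
      Moving : Pred (Formula ((s ≡_) with-names D+d) []) (ℓ ⊔ m)
      Moving φ = Σ[ ψ ∈ Formula ⌜ D ⌝ (s ∷ []) ] Sat (self D) (d ∷ []) ψ ×
        ((x : Carrier s) → ¬ x ≡ d → Sat (self D) (x ∷ []) ψ → Sat (point x over D+d) [] φ)

      _∧′_ : Formula ⌜ D ⌝ (s ∷ []) → Formula ⌜ D ⌝ (s ∷ []) → Formula ⌜ D ⌝ (s ∷ [])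
      φ ∧′ ψ = (φ ⇒ ψ ⇒ ⊥′) ⇒ ⊥′

      Sat-∧′ : (x : Carrier s) (φ ψ : Formula ⌜ D ⌝ (s ∷ [])) → Sat (self D) (x ∷ []) (φ ∧′ ψ) →
               Sat (self D) (x ∷ []) φ × Sat (self D) (x ∷ []) ψ
      Sat-∧′ x φ ψ p with em _ {P = Sat (self D) (x ∷ []) φ × Sat (self D) (x ∷ []) ψ}
      ... | yes q = q
      ... | no ¬q = ⊥-elim (lower (p (λ q r → lift (¬q (q , r)))))

    -- If d is not definable over D, then the type of d over D has a realization other
    -- than d, and d can be moved there by an automorphism over D.
    dcl-of-fixed : ((σ : Automorphism) → FixesPointwise σ D → map σ s d ≡ d) → (s , d) ∈ dcl D
    dcl-of-fixed fixed with em _ {P = (s , d) ∈ dcl D}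
    ... | yes d∈ = d∈
    ... | no ¬d∈ = ⊥-elim (d′≢d (trans (sym σd≡d′) (fixed σ fixes)))
      where
      another : (ψ : Formula ⌜ D ⌝ (s ∷ [])) → Sat (self D) (d ∷ []) ψ →
                Σ[ x ∈ Carrier s ] ¬ x ≡ d × Sat (self D) (x ∷ []) ψ
      another ψ p with em _ {P = Σ[ x ∈ Carrier s ] ¬ x ≡ d × Sat (self D) (x ∷ []) ψ}
      ... | yes q = q
      ... | no ¬q = ⊥-elim (¬d∈ (ψ , p , unique))
        where
        unique : ∀ x → Sat (self D) (x ∷ []) ψ → x ≡ d
        unique x r with em _ {P = x ≡ d}
        ... | yes x≡d = x≡d
        ... | no x≢d  = ⊥-elim (¬q (x , x≢d , r))

      gather : (φs : List (Formula ((s ≡_) with-names D+d) [])) → All Moving φs →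
               Σ[ ψ ∈ Formula ⌜ D ⌝ (s ∷ []) ] Sat (self D) (d ∷ []) ψ ×
               ((x : Carrier s) → ¬ x ≡ d → Sat (self D) (x ∷ []) ψ →
                All (Sat (point x over D+d) []) φs)
      gather []       []                  = ⊥′ ⇒ ⊥′ , id , λ _ _ _ → []
      gather (φ ∷ φs) ((ψ , p , q) ∷ πs) =
        let ψs , ps , qs = gather φs πs in
        ψ ∧′ ψs , (λ r → r p ps) , λ x x≢d r →
          q x x≢d (proj₁ (Sat-∧′ x ψ ψs r)) ∷ qs x x≢d (proj₂ (Sat-∧′ x ψ ψs r))

      realization : Σ[ t ∈ Tuple (s ≡_) ] (∀ {φ} → φ ∈ Moving → Sat (t over D+d) [] φ)
      realization = saturated D+d small-D+d (s ≡_) Moving λ φs πs →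
        let ψ , p , q = gather φs πs
            x , x≢d , r = another ψ p
        in point x , q x x≢d r

      t : Tuple (s ≡_)
      t = proj₁ realization
      d′ : Carrier s
      d′ = t s refl

      d′≢d : ¬ d′ ≡ d
      -- The inequality lies in `Moving` with the trivially true `⊥′ ⇒ ⊥′` as its formula about `d`.
      d′≢d eq = lower (proj₂ realization
        {(name (inj₁ refl) ≈ name (inj₂ (d , inj₂ refl))) ⇒ ⊥′}
        (⊥′ ⇒ ⊥′ , id , λ _ x≢d _ x≡d → lift (x≢d x≡d)) eq)

      module _ (ψ : Formula ⌜ D ⌝ (s ∷ [])) where
        rename : NameMap ((s ≡_) with-names D+d) (namesᶠ ψ) []
        rename (x , x∈) _ = inj₁ (inj₂ (x , inj₁ x∈))
        close : VarMap ((s ≡_) with-names D+d) (s ∷ []) []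
        close (here refl) = inj₁ (inj₁ refl)
        closed : (t : Tuple (s ≡_)) →
                 Sat (t over D+d) [] (subᶠ ψ rename close) ⇔ Sat (self D) (t s refl ∷ []) ψ
        closed t = Sat-sub (t over D+d) (self D) ψ rename close (λ _ _ → refl) (λ { (here refl) → refl })

        transfer : Sat (self D) (d ∷ []) ψ → Sat (self D) (d′ ∷ []) ψ
        transfer p = to (closed t) (proj₂ realization {subᶠ ψ rename close}
          (ψ , p , λ x _ → from (closed (point x))))

      -- Strong homogeneity speaks of small tuples, so `D` is enumerated by `K`, with one further
      -- entry for the point to be moved.
      W : Sort → Set ℓ
      W s′ = (Σ[ i ∈ K ] proj₁ (k i) ≡ s′) ⊎ s ≡ s′

      enum : Carrier s → Tuple W
      (enum x) _ (inj₁ (i , refl)) = proj₂ (k i)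
      (enum x) _ (inj₂ refl)       = x

      module _ (φ : Formula (W with-names ∅) []) where
        open′ : NameMap ⌜ D ⌝ (namesᶠ φ) (s ∷ [])
        open′ (inj₁ (inj₁ (i , refl))) _ = inj₁ (proj₂ (k i) , proj₂ D≐k (i , refl))
        open′ (inj₁ (inj₂ refl))       _ = inj₂ (here refl)
        opened : (x : Carrier s) →
                 Sat (self D) (x ∷ []) (subᶠ φ open′ (λ ())) ⇔ Sat ((enum x) over ∅) [] φ
        opened x = Sat-sub (self D) ((enum x) over ∅) φ open′ (λ ())
          (λ { (inj₁ (inj₁ (i , refl))) _ → refl ; (inj₁ (inj₂ refl)) _ → refl }) (λ ())

      move : Σ[ σ ∈ Automorphism ] (∀ s x → map σ s ((enum d) s x) ≡ (enum d′) s x)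
      move = strongly-homogeneous W (enum d) (enum d′) (SameType-⊆ em λ φ p →
        to (opened φ d′) (transfer (subᶠ φ (open′ φ) (λ ())) (from (opened φ d) p)))
      σ : Automorphism
      σ = proj₁ move
      σd≡d′ : map σ s d ≡ d′
      σd≡d′ = proj₂ move s (inj₂ refl)
      fixes : FixesPointwise σ D
      fixes x∈ with proj₁ D≐k x∈
      ... | i , refl = proj₂ move _ (inj₁ (i , refl))

  -- Kernel elements are defined by one formula along all equivalent sequences.

  module _ {n : ℕ} {V : Sort → Set ℓ} {s : Sort}
           (ψ : Formula ((λ s → Fin n × V s) with-names ∅) (s ∷ [])) where

    Defines : Tuple (λ s → Fin n × V s) → Carrier s → Set m
    Defines t d = Sat (t over ∅) (d ∷ []) ψ × ((x : Carrier s) → Sat (t over ∅) (x ∷ []) ψ → x ≡ d)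

    DefinesFrom : Sequence V → Carrier s → Set (ℓ ⊔ m)
    DefinesFrom a d = (i : Fin n → Index a) → i Preserves Fin._<_ ⟶ _<_ a →
                      Defines (flat (at a ∘ i)) d

    module _ {K : Set ℓ} {_<′_ : Rel K ℓ} {f : K → Tuple V}
             (indiscernible : IndiscernibleFamily ∅ _<′_ f) where

      private
        Twice : Sort → Set ℓ
        Twice s = (Fin n ⊎ Fin n) × V s

        module _ (half : Fin n → Fin n ⊎ Fin n) where
          rename : NameMap (Twice with-names ∅) (namesᶠ ψ) (s ∷ [])
          rename (inj₁ (p , x)) _ = inj₁ (inj₁ (half p , x))
          at-half : Formula (Twice with-names ∅) (s ∷ [])
          at-half = subᶠ ψ rename inj₂
          Sat-half : (g : Fin n ⊎ Fin n → Tuple V) (x : Carrier s) →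
                     Sat (flat g over ∅) (x ∷ []) at-half ⇔ Sat (flat (g ∘ half) over ∅) (x ∷ []) ψ
          Sat-half g x = Sat-sub (flat g over ∅) (flat (g ∘ half) over ∅) ψ rename inj₂
            (λ { (inj₁ _) _ → refl }) (λ _ → refl)

      -- That the two halves of a double tuple define the same element is part of its type.
      halves-agree :
        {u v : Fin n ⊎ Fin n → K} →
        u Preserves (Fin._<_ ⊎-< Fin._<_) ⟶ _<′_ → v Preserves (Fin._<_ ⊎-< Fin._<_) ⟶ _<′_ →
        {d : Carrier s} → Defines (flat (f ∘ u ∘ inj₁)) d → Defines (flat (f ∘ u ∘ inj₂)) d →
        (x : Carrier s) →
        Sat (flat (f ∘ v ∘ inj₁) over ∅) (x ∷ []) ψ ⇔ Sat (flat (f ∘ v ∘ inj₂) over ∅) (x ∷ []) ψ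
      halves-agree {u} {v} u↑ v↑ {d} (p₁ , unique₁) (p₂ , unique₂) x = mk⇔
        -- Along `u` both halves have `d` as their only solution, so each implies the other there.
        (implies inj₁ inj₂ (λ y q → subst (Holds inj₂) (sym (unique₁ y q)) p₂) x)
        (implies inj₂ inj₁ (λ y q → subst (Holds inj₁) (sym (unique₂ y q)) p₁) x)
        where
        Holds : (Fin n → Fin n ⊎ Fin n) → Carrier s → Set m
        Holds half y = Sat (flat (f ∘ u ∘ half) over ∅) (y ∷ []) ψ
        implies : (g h : Fin n → Fin n ⊎ Fin n) → (∀ y → Holds g y → Holds h y) →
                  ∀ y → Sat (flat (f ∘ v ∘ g) over ∅) (y ∷ []) ψ →
                        Sat (flat (f ∘ v ∘ h) over ∅) (y ∷ []) ψ
        -- The implication between the halves is transferred from `u` to `v` as one universally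
        -- quantified formula.
        implies g h g⇒h y =
          to (Sat-half h (f ∘ v) y) ∘
          to (indiscernible-along {_<_ = _<′_} {a = f} indiscernible
                (⊎-<-isStrictTotalOrder-≡ Fin.<-isStrictTotalOrder Fin.<-isStrictTotalOrder)
                {u} {v} u↑ v↑ (all s (at-half g ⇒ at-half h)))
             (λ z → from (Sat-half h (f ∘ u) z) ∘ g⇒h z ∘ to (Sat-half g (f ∘ u) z)) y ∘
          from (Sat-half g (f ∘ v) y)

    Defines-⇔ : {t t′ : Tuple (λ s → Fin n × V s)} {d : Carrier s} →
                ((x : Carrier s) → Sat (t over ∅) (x ∷ []) ψ ⇔ Sat (t′ over ∅) (x ∷ []) ψ) →
                Defines t d → Defines t′ d
    Defines-⇔ t⇔t′ (p , unique) = to (t⇔t′ _) p , λ x → unique x ∘ from (t⇔t′ x)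

    double-chain : (a : Sequence V) → Σ[ u ∈ (Fin n ⊎ Fin n → Index a) ]
                                        u Preserves (Fin._<_ ⊎-< Fin._<_) ⟶ _<_ a
    double-chain a =
      let u , u↑ = finite-embedding em (isStrictTotalOrder a) (infinite a)
                     (⊎-<-isStrictTotalOrder-≡ Fin.<-isStrictTotalOrder Fin.<-isStrictTotalOrder)
                     (List.tabulate inj₁ ++ List.tabulate inj₂)
      in u , u↑ (listed _) (listed _)
      where
      listed : (p : Fin n ⊎ Fin n) → p ∈ₗ List.tabulate inj₁ ++ List.tabulate inj₂
      listed (inj₁ p) = ∈-++⁺ˡ (∈-tabulate⁺ p)
      listed (inj₂ p) = ∈-++⁺ʳ _ (∈-tabulate⁺ p)

    -- Two successive tuples of `a` both define `d`. Keeping the lower one and placing `j` after it,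
    -- or before it if `b` comes first, gives another increasing double tuple, whose halves must
    -- agree too.
    defines-from-collinear : {a b : Sequence V} {d : Carrier s} → CleanlyCollinear a b →
                             DefinesFrom a d → DefinesFrom b d
    defines-from-collinear {a} {b} collinear A j j↑ with double-chain a
    ... | u , u↑ with collinear
    ...   | inj₁ ab = Defines-⇔
            (halves-agree {_<′_ = _<_ a ⊎-< _<_ b} {f = at a ⊕ at b} ab {inj₁ ∘ u} {Sum.map (u ∘ inj₁) j}
              (λ p<q → ₁∼₁ (u↑ p<q))
              (λ { ₁∼₂ → ₁∼₂ ; (₁∼₁ p<q) → ₁∼₁ (u↑ (₁∼₁ p<q)) ; (₂∼₂ p<q) → ₂∼₂ (j↑ p<q) })
              (A (u ∘ inj₁) (λ p<q → u↑ (₁∼₁ p<q))) (A (u ∘ inj₂) (λ p<q → u↑ (₂∼₂ p<q))))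
            (A (u ∘ inj₁) (λ p<q → u↑ (₁∼₁ p<q)))
    ...   | inj₂ ba = Defines-⇔
            (λ x → let agree = halves-agree {_<′_ = _<_ b ⊎-< _<_ a} {f = at b ⊕ at a} ba {inj₂ ∘ u} {Sum.map j (u ∘ inj₁)}
                         (λ p<q → ₂∼₂ (u↑ p<q))
                         (λ { ₁∼₂ → ₁∼₂ ; (₁∼₁ p<q) → ₁∼₁ (j↑ p<q) ; (₂∼₂ p<q) → ₂∼₂ (u↑ (₁∼₁ p<q)) })
                         (A (u ∘ inj₁) (λ p<q → u↑ (₁∼₁ p<q))) (A (u ∘ inj₂) (λ p<q → u↑ (₂∼₂ p<q))) x
                   in mk⇔ (from agree) (to agree))
            (A (u ∘ inj₁) (λ p<q → u↑ (₁∼₁ p<q)))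

    defines-from-≋ : {a b : Sequence V} {d : Carrier s} → a ≋ b → DefinesFrom a d → DefinesFrom b d
    defines-from-≋ {a} {b} [ ab ]⁺ A = defines-from-collinear {a} {b} ab A
    defines-from-≋ {a} (_∷_ {y = c} ac cb) A = defines-from-≋ cb (defines-from-collinear {a} {c} ac A)

    defines-from-image : (σ : Automorphism) {a : Sequence V} {d : Carrier s} →
                         DefinesFrom a d → DefinesFrom (image σ a) (map σ s d)
    defines-from-image σ {a} {d} A i i↑ =
      to (moved d) (proj₁ (A i i↑)) , λ x p →
        trans (sym (strictlyInverseˡ x)) (cong (map σ s) (proj₂ (A i i↑) (Inverse.from (bijection σ s) x)
          (from (moved _) (subst (λ x → Sat (flat (at (image σ a) ∘ i) over ∅) (x ∷ []) ψ)
                                 (sym (strictlyInverseˡ x)) p))))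
      where
      open Inverse (bijection σ s) using (strictlyInverseˡ)
      moved : (x : Carrier s) → Sat (flat (at a ∘ i) over ∅) (x ∷ []) ψ ⇔
                                Sat (flat (at (image σ a) ∘ i) over ∅) (map σ s x ∷ []) ψ
      moved x = Sat-over-map σ (λ ()) (flat (at a ∘ i)) (x ∷ []) ψ

  -- A definition of `d` over the range uses one finite chain `e`. That it defines `d` is
  -- expressible with `d` as parameter, so indiscernibility over `d` carries it from `e` to every
  -- `i`.
  ker-definition : {V : Sort → Set ℓ} (a : Sequence V) {s : Sort} {d : Carrier s} → (s , d) ∈ ker a →
                   Σ[ n ∈ ℕ ] Σ[ ψ ∈ Formula ((λ s → Fin n × V s) with-names ∅) (s ∷ []) ]
                     DefinesFrom ψ a d
  ker-definition {V} a {s} {d} ((φ , holds , unique) , A) = n , ψ , λ i i↑ →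
      to (here⇔ i) (to (A n e i e↑ i↑ defined) (from (here⇔ e) (from (ψ⇔φ d) holds)))
    , to (only⇔ i) (to (A n e i e↑ i↑ only) (from (only⇔ e) (λ x → unique x ∘ to (ψ⇔φ x))))
    where
    -- A parameter from `range a` comes with an index and a coordinate, which replace it.
    to-index : NameMap ((λ s → Index a × V s) with-names ∅) (namesᶠ φ) (s ∷ [])
    to-index (_ , i , v , _) _ = inj₁ (inj₁ (i , v))
    support = finite-support {D = ∅} (isStrictTotalOrder a) (subᶠ φ to-index inj₂)
    n : ℕ
    n = proj₁ support
    e : Fin n → Index a
    e = proj₁ (proj₂ support)
    e↑ : e Preserves Fin._<_ ⟶ _<_ a
    e↑ = proj₁ (proj₂ (proj₂ support))
    V×n : Sort → Set ℓ
    V×n s = Fin n × V s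
    ψ : Formula (V×n with-names ∅) (s ∷ [])
    ψ = proj₁ (proj₂ (proj₂ (proj₂ support)))
    ψ⇔φ : (x : Carrier s) →
          Sat (flat (at a ∘ e) over ∅) (x ∷ []) ψ ⇔ Sat (self (range a)) (x ∷ []) φ
    ψ⇔φ x = mk⇔ (to φ′⇔φ ∘ to ψ⇔φ′) (from ψ⇔φ′ ∘ from φ′⇔φ)
      where
      ψ⇔φ′ = proj₂ (proj₂ (proj₂ (proj₂ support))) (at a) (x ∷ [])
      φ′⇔φ = Sat-sub (flat (at a) over ∅) (self (range a)) φ to-index inj₂ {x ∷ []} {x ∷ []}
               (λ { (_ , _ , _ , eq) _ → eq }) (λ _ → refl)

    name-d : Term (V×n with-names ｛ s , d ｝) (s ∷ []) s
    name-d = name (inj₂ (d , refl))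
    keep : {Γ : List Sort} → NameMap (V×n with-names ｛ s , d ｝) (namesᶠ ψ) Γ
    keep (inj₁ y) _ = inj₁ (inj₁ y)
    close : VarMap (V×n with-names ｛ s , d ｝) (s ∷ []) []
    close (here refl) = inj₁ (inj₂ (d , refl))
    defined only : Formula (V×n with-names ｛ s , d ｝) []
    defined = subᶠ ψ keep close
    only  = all s (subᶠ ψ keep inj₂ ⇒ var (here refl) ≈ name-d)

    module _ (i : Fin n → Index a) where
      t : Tuple V×n
      t = flat (at a ∘ i)
      here⇔ : Sat (t over ｛ s , d ｝) [] defined ⇔ Sat (t over ∅) (d ∷ []) ψ
      here⇔ = Sat-sub (t over ｛ s , d ｝) (t over ∅) ψ keep close
                (λ { (inj₁ _) _ → refl }) (λ { (here refl) → refl })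
      body⇔ : (x : Carrier s) →
              Sat (t over ｛ s , d ｝) (x ∷ []) (subᶠ ψ keep inj₂) ⇔ Sat (t over ∅) (x ∷ []) ψ
      body⇔ x = Sat-sub (t over ｛ s , d ｝) (t over ∅) ψ keep inj₂
                  (λ { (inj₁ _) _ → refl }) (λ _ → refl)
      only⇔ : Sat (t over ｛ s , d ｝) [] only ⇔ (∀ x → Sat (t over ∅) (x ∷ []) ψ → x ≡ d)
      only⇔ = mk⇔ (λ p x → p x ∘ from (body⇔ x)) (λ p x → p x ∘ to (body⇔ x))

  -- One formula defines `d` from `a` and `map σ s d` from `image σ a`, hence the latter from `a` as
  -- well; a single tuple of `a` then forces equality.
  fixes-ker : {V : Sort → Set ℓ} (a : Sequence V) (σ : Automorphism) → image σ a ≋ a →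
              FixesPointwise σ (ker a)
  fixes-ker a σ σa≋a {s} {d} d∈ =
    let n , ψ , A = ker-definition a d∈
        i , i↑    = FiniteChains.chain (isStrictTotalOrder a) em (infinite a) n
    in proj₂ (A i i↑) (map σ s d)
         (proj₁ (defines-from-≋ ψ {image σ a} {a} σa≋a (defines-from-image ψ σ {a} {d} A) i i↑))

  -- The canonical base lies in the kernel.

  module _ {V : Sort → Set ℓ} (a : Sequence V) (c : Index a → Tuple V)
           (ac : IndiscernibleFamily ∅ (_<_ a ⊎-< _<_ a) (at a ⊕ c))
           (B : Subset) (base : IsCanonicalBase B a) where

    private
      O : IsStrictTotalOrder _≡_ (_<_ a)
      O = isStrictTotalOrder a
      _<²_ : Rel (Index a ⊎ Index a) ℓ
      _<²_ = _<_ a ⊎-< _<_ a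

      image-≋ : (σ : Automorphism) → IndiscernibleFamily ∅ _<²_ (at (image σ a) ⊕ c) → image σ a ≋ a
      image-≋ σ σac = _∷_ {y = tail} (inj₁ σac) [ inj₂ ac ]⁺
        where
        tail : Sequence V
        tail = record { Index = Index a ; _<_ = _<_ a ; isStrictTotalOrder = O
                      ; infinite = infinite a ; at = c }

    -- Here `image σ a` followed by `c` is pointwise the indiscernible `a` followed by `c`.
    fixes-range⇒fixes-base : (σ : Automorphism) → FixesPointwise σ (range a) → FixesPointwise σ B
    fixes-range⇒fixes-base σ fixes = from (base σ) (image-≋ σ
      (indiscernible-≡ {_<_ = _<²_} {at a ⊕ c} {at (image σ a) ⊕ c}
        (λ { (inj₁ i) s x → sym (fixes (i , x , refl)) ; (inj₂ i) s x → refl }) ac))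

    -- Here `image σ a` followed by `c` is the image under `σ` of `a` followed by `c`.
    fixes-continuation⇒fixes-base : (σ : Automorphism) → (∀ i s x → map σ s (c i s x) ≡ c i s x) →
                                    FixesPointwise σ B
    fixes-continuation⇒fixes-base σ fixes = from (base σ) (image-≋ σ
      (indiscernible-≡ {_<_ = _<²_} {λ k → σ · (at a ⊕ c) k} {at (image σ a) ⊕ c}
        (λ { (inj₁ i) s x → refl ; (inj₂ i) s x → fixes i s x })
        (indiscernible-map {_<_ = _<²_} {at a ⊕ c} σ ac)))

    small-range : Small (range a)
    small-range = (Index a × Σ Sort V) , (λ { (i , s , x) → s , at a i s x })
      , (λ { (i , x , refl) → (i , _ , x) , refl }) , λ { ((i , _ , x) , refl) → i , x , refl }

    base⊆dcl-range : B ⊆ dcl (range a)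
    base⊆dcl-range {s , b} b∈ =
      dcl-of-fixed (range a) small-range b (λ σ fixes → fixes-range⇒fixes-base σ fixes b∈)

    -- Two increasing tuples of a have the same type over the continuation c, hence are
    -- conjugate by an automorphism fixing c and therefore also the base.
    indiscernible-over-base : {s : Sort} {b : Carrier s} → (s , b) ∈ B → IndiscernibleOver ｛ s , b ｝ a
    indiscernible-over-base {s} {b} b∈ n i j i↑ j↑ φ = mk⇔
      (Sat-cong conjugate φ ∘ to (Sat-over-map σ fixes-b (flat (at a ∘ i)) [] φ))
      (from (Sat-over-map σ fixes-b (flat (at a ∘ i)) [] φ) ∘ Sat-cong (λ s x → sym (conjugate s x)) φ)
      where
      -- All of `c` is appended to the finite tuple, so that the automorphism taking `i` to `j` also
      -- fixes `c`.
      extend : (Fin n → Index a) → Fin n ⊎ Index a → Index a ⊎ Index a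
      extend i = Sum.map i id
      extend-↑ : (i : Fin n → Index a) → i Preserves Fin._<_ ⟶ _<_ a →
                 extend i Preserves (Fin._<_ ⊎-< _<_ a) ⟶ _<²_
      extend-↑ i i↑ ₁∼₂       = ₁∼₂
      extend-↑ i i↑ (₁∼₁ p<q) = ₁∼₁ (i↑ p<q)
      extend-↑ i i↑ (₂∼₂ p<q) = ₂∼₂ p<q
      move : Σ[ σ ∈ Automorphism ] (∀ s x → map σ s (flat ((at a ⊕ c) ∘ extend i) s x) ≡
                                            flat ((at a ⊕ c) ∘ extend j) s x)
      move = strongly-homogeneous (λ s → (Fin n ⊎ Index a) × V s)
        (flat ((at a ⊕ c) ∘ extend i)) (flat ((at a ⊕ c) ∘ extend j))
        (indiscernible-along {_<_ = _<²_} {a = at a ⊕ c} ac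
          (⊎-<-isStrictTotalOrder-≡ Fin.<-isStrictTotalOrder O) {extend i} {extend j}
          (extend-↑ i i↑) (extend-↑ j j↑))
      σ : Automorphism
      σ = proj₁ move
      fixes-b : ∀ {s′ x} → (s′ , x) ∈ ｛ s , b ｝ → map σ s′ x ≡ x
      fixes-b refl = fixes-continuation⇒fixes-base σ (λ k s x → proj₂ move s (inj₂ k , x)) b∈
      conjugate : ∀ s′ x → ((σ · flat (at a ∘ i)) over ｛ s , b ｝) s′ x ≡
                           (flat (at a ∘ j) over ｛ s , b ｝) s′ x
      conjugate = over-cong λ { s′ (p , x) → proj₂ move s′ (inj₁ p , x) }

    base⊆ker : B ⊆ ker a
    base⊆ker b∈ = base⊆dcl-range b∈ , indiscernible-over-base b∈

-- Interdefinability of the base and the kernel.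

corollary3p15 : ((e : Level) → ExcludedMiddle e) →
    {ℓ m : Level} (L : Language ℓ) →
    (T : Syntax.Theory L) → Consistent T → Complete T →
    (M : Structure L m) → Semantics.ModelOf M T →
    let open ModelTheory M in
    BigSaturated →
    (V : Language.Sort L → Set ℓ) (a : Sequence V) → Indiscernible a →
    (B : Subset) → Small B → IsCanonicalBase B a →
    dcl B ≐ dcl (ker a)
corollary3p15 em L T _ _ M _ big V a A B small base =
    dcl-mono (base⊆ker a (proj₁ (continuation a A)) (proj₂ (continuation a A)) B base)
  -- An automorphism fixing `B` takes `a` to an equivalent sequence, hence fixes `ker a` and its
  -- definable closure.
  , λ {x} x∈ → dcl-of-fixed B small (proj₂ x) (λ σ fixes →
      fixes-dcl {ker a} σ (fixes-ker a σ (to (base σ) fixes)) x∈)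
  where
  open Monster em M big
  open ModelTheory M
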